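{- For every integer $m\ge 5$, $$\mathcal{G}(\mathcal{P}_{0,1}(m,1))=\mathcal{G}(\mathcal{P}_{1,0}(m,1)) = \mathcal{G}(\mathcal{P}_{0,1}(m,2))=\mathcal{G}(\mathcal{P}_{1,0}(m,2)).$$
   Context: Toggle: Let $G$ be a finite simple graph, with $N[v]$ the closed neighborhood of $v$. A position $\{G,V_0\}$ consists of $G$ and a set $V_0\subseteq V(G)$ of vertices of weight $0$; all other vertices have weight $1$. Let $\sigma(v)$ be the sum of the weights of the vertices in $N[v]$. A legal move consists of choosing a vertex $v$ of weight $1$ and switching the weight ($0\leftrightarrow 1$) of every vertex of $N[v]$; it is allowed only if $\sigma(v)$ after the switch is strictly smaller than $\sigma(v)$ before it. Two players alternate legal moves; a player with no legal move loses. Nimbers: $\mathcal{G}(\mathcal{S})=\mathrm{mex}\{\mathcal{G}(\mathcal{S}') : \mathcal{S}' \text{ reachable from } \mathcal{S} \text{ by one legal move}\}$, where $\mathrm{mex}(T)$ is the least nonnegative integer not in the finite set $T$ (so $\mathrm{mex}(\emptyset)=0$). The generalized Petersen graph $P(m,k)$ ($1\le k\le\lfloor\frac{m-1}{2}\rfloor$) has inner vertices $v_{0,1},\dots,v_{0,m}$ and outer vertices $v_{1,1},\dots,v_{1,m}$ (second indices modulo $m$), with edges $v_{1,i}v_{1,i+1}$, $v_{0,i}v_{0,i+k}$ and $v_{0,i}v_{1,i}$ for all $i$. Positions on $P(m,k)$: $\mathcal{P}_{0,1}(m,k)$ has all inner vertices of weight $0$ and all outer vertices of weight $1$; $\mathcal{P}_{1,0}(m,k)$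 has all inner vertices of weight $1$ and all outer vertices of weight $0$. -}

module Defs where

open import Data.Bool using (Bool; true; false; not; if_then_else_)
open import Data.Empty using (⊥)
open import Data.Fin using (Fin; zero; suc; toℕ; fromℕ<)
open import Data.Fin.Properties as Fin
  using (toℕ-fromℕ<; toℕ-inject; nonZeroIndex; pigeonhole; ¬∀⟶∃¬-smallest)
open import Data.List using (lookup; List; []; _∷_; map; filter; length; mapMaybe; allFin; cartesianProduct)
open import Data.List.Membership.DecPropositional using () renaming (_∈?_ to member?)
open import Data.List.Membership.Propositional using (_∈_; _∉_)
open import Data.List.Membership.Propositional.Properties using (∈-allFin; ∈-cartesianProduct⁺)
open import Data.List.Relation.Unary.Any using (index)
open import Data.List.Relation.Unary.Any.Properties using (lookup-index)
open import Data.List.Relation.Unary.Unique.Propositional using (Unique)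
open import Data.List.Relation.Unary.Unique.Propositional.Properties using (allFin⁺; cartesianProduct⁺)
open import Data.Maybe as Maybe using ()
open import Data.Nat using (ℕ; zero; suc; _+_; _*_; _∸_; _≤_; _<_; z≤n; s≤s; ⌊_/2⌋)
open import Data.Nat.DivMod using (_mod_; _%_; _/_; m%n<n; m≡m%n+[m/n]*n)
open import Data.Nat.Induction using (<-wellFounded)
open import Data.Nat.ListAction using (sum)
open import Data.Nat.Properties as ℕ
  using (n<1+n; <⇒≢; <⇒≱; +-assoc; +-comm; +-mono-<-≤; +-cancelˡ-≡; ∸-monoˡ-≤; m≤m+n;
         ≤-refl; ≤-reflexive; ≤-trans; ≤-<-trans; ⌊n/2⌋≤n; ⌊n/2⌋-mono; _<?_)
open import Data.Product using (∃; _×_; _,_; proj₁; proj₂)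
open import Data.Product.Properties using (≡-dec)
open import Data.Sum using (_⊎_; inj₁; inj₂; swap)
open import Function using (_∘_; flip)
open import Level using (0ℓ)
open import Induction.WellFounded using (Acc; acc; WellFounded; module Subrelation)
open import Relation.Binary using (Rel; Decidable; DecidableEquality; Symmetric; Irreflexive)
import Relation.Binary.Construct.On as On
open import Relation.Binary.PropositionalEquality
  using (_≡_; _≢_; refl; sym; trans; cong; cong₂; subst; subst₂)
open import Relation.Nullary using (¬_; Dec; yes; no; does; ¬?)
open import Relation.Nullary.Decidable using (dec-false; dec⇒maybe; map′; _×-dec_; _⊎-dec_)
import Relation.Unary as U

record FiniteSimpleGraph : Set₁ where
  field
    Vertex      : Set
    vertices    : List Vertex
    complete    : ∀ v → v ∈ vertices
    unique      : Unique vertices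
    _≟_         : DecidableEquality Vertex
    Adj         : Rel Vertex 0ℓ
    adj?        : Decidable Adj
    symmetric   : Symmetric Adj
    irreflexive : Irreflexive _≡_ Adj

leastAbsent : (T : List ℕ) → ∃ λ n → n ∉ T × (∀ k → k < n → k ∈ T)
leastAbsent T with ¬∀⟶∃¬-smallest (suc (length T)) (λ i → toℕ i ∈ T) (λ i → member? ℕ._≟_ (toℕ i) T) notAll
  where
  notAll : ¬ (∀ (i : Fin (suc (length T))) → toℕ i ∈ T)
  notAll h with pigeonhole (n<1+n _) (λ i → index (h i))
  ... | i , j , i<j , eq = <⇒≢ i<j
    (trans (lookup-index (h i)) (trans (cong (lookup T) eq) (sym (lookup-index (h j)))))
... | i , i∉T , below = toℕ i , i∉T , λ k k<i →
  subst (_∈ T) (trans (toℕ-inject (fromℕ< k<i)) (toℕ-fromℕ< k<i)) (below (fromℕ< k<i))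

mex : List ℕ → ℕ
mex T = proj₁ (leastAbsent T)

private
  sum-split : {A : Set} {P : U.Pred A 0ℓ} (P? : U.Decidable P) (f : A → ℕ) (xs : List A) →
              sum (map f xs) ≡ sum (map f (filter P? xs)) + sum (map f (filter (¬? ∘ P?) xs))
  sum-split P? f [] = refl
  sum-split P? f (x ∷ xs) with P? x
  ... | yes _ = trans (cong (f x +_) (sum-split P? f xs)) (sym (+-assoc (f x) _ _))
  ... | no  _ = trans (cong (f x +_) (sum-split P? f xs)) (x+[y+z]≡y+[x+z] (f x) (sum (map f (filter P? xs))) _)
    where
    x+[y+z]≡y+[x+z] : ∀ x y z → x + (y + z) ≡ y + (x + z)
    x+[y+z]≡y+[x+z] x y z = trans (sym (+-assoc x y z)) (trans (cong (_+ z) (+-comm x y)) (+-assoc y x z))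

  sum-off : {A : Set} {P : U.Pred A 0ℓ} (P? : U.Decidable P) (f g : A → ℕ) →
            (∀ x → ¬ P x → f x ≡ g x) → (xs : List A) →
            sum (map f (filter (¬? ∘ P?) xs)) ≡ sum (map g (filter (¬? ∘ P?) xs))
  sum-off P? f g eq [] = refl
  sum-off P? f g eq (x ∷ xs) with P? x
  ... | yes _  = sum-off P? f g eq xs
  ... | no ¬px = cong₂ _+_ (eq x ¬px) (sum-off P? f g eq xs)

module Toggle (G : FiniteSimpleGraph) where
  open FiniteSimpleGraph G

  -- A position {G, V₀} is given by the characteristic function of V₀:
  -- S v ≡ true means that v has weight 0.
  Position : Set
  Position = Vertex → Bool

  weight : Position → Vertex → ℕ
  weight S v = if S v then 0 else 1

  _∈N[_] : Vertex → Vertex → Set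
  u ∈N[ v ] = u ≡ v ⊎ Adj v u

  _∈N[_]? : ∀ u v → Dec (u ∈N[ v ])
  u ∈N[ v ]? = (u ≟ v) ⊎-dec adj? v u

  N[_] : Vertex → List Vertex
  N[ v ] = filter (_∈N[ v ]?) vertices

  σ : Position → Vertex → ℕ
  σ S v = sum (map (weight S) N[ v ])

  switch : Vertex → Position → Position
  switch v S u = if does (u ∈N[ v ]?) then not (S u) else S u

  Legal : Position → Vertex → Set
  Legal S v = weight S v ≡ 1 × σ (switch v S) v < σ S v

  legal? : ∀ S v → Dec (Legal S v)
  legal? S v = (weight S v ℕ.≟ 1) ×-dec (σ (switch v S) v <? σ S v)

  legalMoves : (S : Position) → List (∃ (Legal S))
  legalMoves S = mapMaybe (λ v → Maybe.map (v ,_) (dec⇒maybe (legal? S v))) vertices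

  _⟶_ : Rel Position 0ℓ
  S ⟶ S′ = ∃ λ v → Legal S v × S′ ≡ switch v S

  -- Play terminates because a legal move lowers the sum of all the weights:
  -- outside N[ v ] nothing changes, and inside it the sum is σ.
  private
    total : Position → ℕ
    total S = sum (map (weight S) vertices)

    total-decreases : ∀ {S S′} → S ⟶ S′ → total S′ < total S
    total-decreases {S} (v , (_ , σ<σ) , refl) =
      subst₂ _<_ (sym (sum-split (_∈N[ v ]?) (weight (switch v S)) vertices))
                 (sym (sum-split (_∈N[ v ]?) (weight S) vertices))
        (+-mono-<-≤ σ<σ (≤-reflexive
          (sum-off (_∈N[ v ]?) (weight (switch v S)) (weight S) unchanged vertices)))
      where
      unchanged : ∀ u → ¬ u ∈N[ v ] → weight (switch v S) u ≡ weight S u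
      unchanged u u∉N rewrite dec-false (u ∈N[ v ]?) u∉N = refl

  ⟶-wellFounded : WellFounded (flip _⟶_)
  ⟶-wellFounded = Subrelation.wellFounded total-decreases (On.wellFounded total <-wellFounded)

  nimberAcc : (S : Position) → Acc (flip _⟶_) S → ℕ
  nimberAcc S (acc rs) = mex (map (λ (v , l) → nimberAcc (switch v S) (rs (v , l , refl))) (legalMoves S))

  𝒢 : Position → ℕ
  𝒢 S = nimberAcc S (⟶-wellFounded S)

open Toggle public using (Position; 𝒢)

-- Second indices are taken in Fin m, i.e. 0, …, m − 1 instead of 1, …, m.
PetersenVertex : ℕ → Set
PetersenVertex m = Fin 2 × Fin m

pattern inner i = zero , i
pattern outer i = suc zero , i

shift : ∀ {m} → ℕ → Fin m → Fin m
shift {m} s i = _mod_ (toℕ i + s) m {{nonZeroIndex i}}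

data PetersenEdge {m} (k : ℕ) : Rel (PetersenVertex m) 0ℓ where
  outerEdge : ∀ i → PetersenEdge k (outer i) (outer (shift 1 i))
  innerEdge : ∀ i → PetersenEdge k (inner i) (inner (shift k i))
  spoke     : ∀ i → PetersenEdge k (inner i) (outer i)

petersenEdge? : ∀ {m} k → Decidable (PetersenEdge {m} k)
petersenEdge? k (inner i) (inner j) = map′ (λ { refl → innerEdge i }) (λ { (innerEdge _) → refl }) (shift k i Fin.≟ j)
petersenEdge? k (inner i) (outer j) = map′ (λ { refl → spoke i }) (λ { (spoke _) → refl }) (i Fin.≟ j)
petersenEdge? k (outer i) (inner j) = no λ ()
petersenEdge? k (outer i) (outer j) = map′ (λ { refl → outerEdge i }) (λ { (outerEdge _) → refl }) (shift 1 i Fin.≟ j)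

shift-≢ : ∀ {m} s (i : Fin m) → 1 ≤ s → s < m → shift s i ≢ i
shift-≢ {m} s i 1≤s s<m eq = absurd ((toℕ i + s) / m) s≡q*m
  where
  instance _ = nonZeroIndex i
  %≡ : (toℕ i + s) % m ≡ toℕ i
  %≡ = trans (sym (toℕ-fromℕ< (m%n<n (toℕ i + s) m))) (cong toℕ eq)
  s≡q*m : s ≡ ((toℕ i + s) / m) * m
  s≡q*m = +-cancelˡ-≡ (toℕ i) _ _
    (trans (m≡m%n+[m/n]*n (toℕ i + s) m) (cong (_+ ((toℕ i + s) / m) * m) %≡))
  absurd : ∀ q → s ≡ q * m → ⊥
  absurd zero    s≡ = <⇒≢ 1≤s (sym s≡)
  absurd (suc q) s≡ = <⇒≱ s<m (≤-trans (m≤m+n m (q * m)) (≤-reflexive (sym s≡)))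

petersen : (m k : ℕ) → 1 ≤ k → k ≤ ⌊ m ∸ 1 /2⌋ → FiniteSimpleGraph
petersen m k 1≤k k≤ = record
  { Vertex      = PetersenVertex m
  ; vertices    = cartesianProduct (allFin 2) (allFin m)
  ; complete    = λ (a , i) → ∈-cartesianProduct⁺ (∈-allFin a) (∈-allFin i)
  ; unique      = cartesianProduct⁺ (allFin⁺ 2) (allFin⁺ m)
  ; _≟_         = ≡-dec Fin._≟_ Fin._≟_
  ; Adj         = λ u v → PetersenEdge k u v ⊎ PetersenEdge k v u
  ; adj?        = λ u v → petersenEdge? k u v ⊎-dec petersenEdge? k v u
  ; symmetric   = swap
  ; irreflexive = λ { u≡v (inj₁ e) → noLoop e u≡v ; u≡v (inj₂ e) → noLoop e (sym u≡v) }
  }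
  where
  k<m : Fin m → k < m
  k<m i = ≤-<-trans (≤-trans k≤ (⌊n/2⌋≤n _)) (pred< i)
    where
    pred< : ∀ {n} → Fin n → n ∸ 1 < n
    pred< {suc n} _ = n<1+n n
  noLoop : ∀ {u v} → PetersenEdge k u v → u ≢ v
  noLoop (outerEdge i) eq = shift-≢ 1 i ≤-refl (≤-<-trans 1≤k (k<m i)) (sym (cong proj₂ eq))
  noLoop (innerEdge i) eq = shift-≢ k i 1≤k (k<m i) (sym (cong proj₂ eq))
  noLoop (spoke i) ()

-- These are positions on petersen m k for every k, since its vertices do not depend on k.
𝒫₀₁ 𝒫₁₀ : ∀ {m} → PetersenVertex m → Bool
𝒫₀₁ (inner _) = true
𝒫₀₁ (outer _) = false
𝒫₁₀ (inner _) = false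
𝒫₁₀ (outer _) = true

2≤⌊m-1/2⌋ : ∀ {m} → 5 ≤ m → 2 ≤ ⌊ m ∸ 1 /2⌋
2≤⌊m-1/2⌋ 5≤m = ⌊n/2⌋-mono (∸-monoˡ-≤ 1 5≤m)

1≤⌊m-1/2⌋ : ∀ {m} → 5 ≤ m → 1 ≤ ⌊ m ∸ 1 /2⌋
1≤⌊m-1/2⌋ 5≤m = ≤-trans (s≤s z≤n) (2≤⌊m-1/2⌋ 5≤m)

{-# OPTIONS --safe #-}
-- In 𝒫₀₁ and 𝒫₁₀ one row of P(m,k) is live and the other is dead. A legal move at a vertex of the
-- live row needs its two row neighbours to be live: it kills all three and revives the vertex
-- opposite. A revived vertex never has three live vertices in its neighbourhood, so it is never
-- played. Hence the game is bisimilar to one on ℤ/m alone: choose i with i − s, i, i + s all live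
-- and kill these three cells, where s is the step of the edges in the live row. Three of the four
-- positions have s = 1; the remaining one has s = 2. For odd m, doubling is an isomorphism between
-- the two games. For even m both have nimber 0: the second player answers i with i + m/2
-- when s = 1, and with the cell paired with i under 2j ↔ 2j + 1 when s = 2; the two triples are disjoint.

module Submission where

open import Defs
open import Data.Bool using (Bool; true; false; not; if_then_else_; _∨_)
open import Data.Bool.Properties using (∨-assoc; ∨-comm; ∨-identityʳ; ∨-zeroʳ; not-¬; ¬-not)
open import Data.Empty using (⊥-elim)
open import Data.Fin using (Fin; zero; suc; toℕ)
open import Data.Fin.Properties as Fin using (toℕ-injective; toℕ-fromℕ<; toℕ<n)
open import Data.List using (List; []; _∷_; map)
open import Data.List.Membership.DecPropositional using () renaming (_∈?_ to member?)
open import Data.List.Membership.Propositional using (_∈_; _∉_; lose)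
open import Data.List.Membership.Propositional.Properties using (∈-map⁺; ∈-map⁻; ∈-filter⁺; ∈-filter⁻)
open import Data.List.Membership.Propositional.Properties.WithK using (unique∧set⇒bag)
open import Data.List.Relation.Binary.BagAndSetEquality using (∼bag⇒↭)
open import Data.List.Relation.Binary.Permutation.Propositional.Properties using (map⁺)
open import Data.List.Relation.Unary.All using ([]; _∷_)
open import Data.List.Relation.Unary.AllPairs using ([]; _∷_)
open import Data.List.Relation.Unary.Any using (here; there)
import Data.List.Relation.Unary.Any.Properties as Any
open import Data.List.Relation.Unary.Unique.Propositional using (Unique)
open import Data.List.Relation.Unary.Unique.Propositional.Properties using (filter⁺)
open import Data.Maybe as Maybe using (Maybe)
import Data.Maybe.Relation.Unary.Any as MaybeAny
open import Data.Nat using (ℕ; zero; suc; _+_; _*_; _∸_; _≤_; _<_; z≤n; s≤s; NonZero; ⌊_/2⌋)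
open import Data.Nat.Divisibility using (_∣_; divides)
open import Data.Nat.DivMod
  using (_mod_; _%_; m%n<n; m%n%n≡m%n; [m+n]%n≡m%n; m<n⇒m%n≡m; %-distribˡ-+; %-distribˡ-*; m∣n⇒o%n%m≡o%m)
open import Data.Nat.ListAction using (sum)
open import Data.Nat.ListAction.Properties using (sum-↭)
open import Data.Nat.Properties as ℕ
  using (+-assoc; +-comm; *-assoc; *-comm; *-identityʳ; *-distribʳ-+; m∸n+n≡m; m+[n∸m]≡n; ≤-trans; <-cmp)
open import Data.Product using (∃; _×_; _,_; proj₁; proj₂)
open import Data.Sum using (_⊎_; inj₁; inj₂)
open import Function using (flip; _∘_; mk⇔)
open import Induction.WellFounded using (Acc; acc)
open import Level using (0ℓ)
open import Relation.Binary using (Rel; tri<; tri≈; tri>)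
open import Relation.Binary.PropositionalEquality
  using (_≡_; _≢_; refl; sym; trans; cong; cong₂; subst; subst₂; module ≡-Reasoning)
open import Relation.Nullary using (¬_; yes; no; contradiction; does)
open import Relation.Nullary.Decidable using (dec⇒maybe; dec-true; dec-false; does-⇔)

-- Nimbers as a relation on positions, and bisimulation.

-- Every smaller value is reached, and `n` is not. The second clause gives each option some other
-- nimber instead of denying it `n`: this keeps the type strictly positive and lets arguments
-- recurse on derivations.
data HasNimber {Pos : Set} (_⟶_ : Rel Pos 0ℓ) (S : Pos) (n : ℕ) : Set where
  hasNimber : (∀ {k} → k < n → ∃ λ S′ → S ⟶ S′ × HasNimber _⟶_ S′ k) →
              (∀ {S′} → S ⟶ S′ → ∃ λ k → k ≢ n × HasNimber _⟶_ S′ k) →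
              HasNimber _⟶_ S n

-- If the values differ, the derivation for the larger one reaches an option having the smaller as
-- nimber, while the other derivation gives that option a different nimber. Induction then applies
-- to the option.
HasNimber-unique : ∀ {Pos} {_⟶_ : Rel Pos 0ℓ} {S a b} →
                   HasNimber _⟶_ S a → HasNimber _⟶_ S b → a ≡ b
HasNimber-unique {a = a} {b} (hasNimber below avoid) (hasNimber below′ avoid′) with <-cmp a b
... | tri≈ _ a≡b _ = a≡b
... | tri< a<b _ _ with below′ a<b
...   | S′ , S⟶S′ , S′:a with avoid S⟶S′
...     | k , k≢a , S′:k = contradiction (HasNimber-unique S′:k S′:a) k≢a
HasNimber-unique {a = a} {b} (hasNimber below avoid) (hasNimber below′ avoid′) | tri> _ _ b<a with below b<a
...   | S′ , S⟶S′ , S′:b with avoid′ S⟶S′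
...     | k , k≢b , S′:k = contradiction (sym (HasNimber-unique S′:b S′:k)) k≢b

record Bisimulation {Pos Pos′ : Set} (_⟶_ : Rel Pos 0ℓ) (_⟶′_ : Rel Pos′ 0ℓ)
                    (R : Pos → Pos′ → Set) : Set where
  field
    forth : ∀ {S T S′} → R S T → S ⟶ S′ → ∃ λ T′ → T ⟶′ T′ × R S′ T′
    back  : ∀ {S T T′} → R S T → T ⟶′ T′ → ∃ λ S′ → S ⟶ S′ × R S′ T′

  -- `forth` carries over the options realising the values below `n`; `back` traces each option of
  -- `T` to one of `S`, where `n` is avoided.
  transport : ∀ {S T n} → R S T → HasNimber _⟶_ S n → HasNimber _⟶′_ T n
  transport {S} {T} {n} r (hasNimber below avoid) = hasNimber below′ avoid′
    where
    below′ : ∀ {k} → k < n → ∃ λ T′ → T ⟶′ T′ × HasNimber _⟶′_ T′ k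
    below′ k<n with below k<n
    ... | S′ , S⟶S′ , S′:k with forth r S⟶S′
    ...   | T′ , T⟶T′ , r′ = T′ , T⟶T′ , transport r′ S′:k
    avoid′ : ∀ {T′} → T ⟶′ T′ → ∃ λ k → k ≢ n × HasNimber _⟶′_ T′ k
    avoid′ T⟶T′ with back r T⟶T′
    ... | S′ , S⟶S′ , r′ with avoid S⟶S′
    ...   | k , k≢n , S′:k = k , k≢n , transport r′ S′:k

-- The mex recursion computes the relational nimber.

mex∉ : ∀ T → mex T ∉ T
mex∉ T = proj₁ (proj₂ (leastAbsent T))

<mex⇒∈ : ∀ T {k} → k < mex T → k ∈ T
<mex⇒∈ T = proj₂ (proj₂ (leastAbsent T)) _

module _ (G : FiniteSimpleGraph) where
  open FiniteSimpleGraph G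
  open Toggle G hiding (Position; 𝒢)

  -- The list carries the legality proof that `legal?` produces, which need not be the given one;
  -- hence the existential.
  legalMoves-complete : ∀ {S v} → Legal S v → ∃ λ l → (v , l) ∈ legalMoves S
  legalMoves-complete {S} {v} l with legal? S v in eq
  ... | no ¬l = contradiction l ¬l
  ... | yes l′ = l′ , Any.mapMaybe⁺ f vertices (Any.map⁺ (lose (complete v) isHead))
    where
    f : Vertex → Maybe (∃ (Legal S))
    f v = Maybe.map (v ,_) (dec⇒maybe (legal? S v))
    isHead : MaybeAny.Any ((v , l′) ≡_) (f v)
    isHead rewrite eq = MaybeAny.just refl

  nimberAcc-correct : ∀ S (a : Acc (flip _⟶_) S) → HasNimber _⟶_ S (nimberAcc S a)
  nimberAcc-correct S (acc rs) = hasNimber below avoid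
    where
    option : ∃ (Legal S) → ℕ
    option (v , l) = nimberAcc (switch v S) (rs (v , l , refl))
    options : List ℕ
    options = map option (legalMoves S)
    reached : ∀ {k} → ∃ (λ l → l ∈ legalMoves S × k ≡ option l) → ∃ λ S′ → S ⟶ S′ × HasNimber _⟶_ S′ k
    reached ((v , l) , _ , refl) = switch v S , (v , l , refl) , nimberAcc-correct _ (rs (v , l , refl))
    below : ∀ {k} → k < mex options → ∃ λ S′ → S ⟶ S′ × HasNimber _⟶_ S′ k
    below k< = reached (∈-map⁻ option (<mex⇒∈ options k<))
    avoided : ∀ {v} → ∃ (λ l → (v , l) ∈ legalMoves S) → ∃ λ k → k ≢ mex options × HasNimber _⟶_ (switch v S) k
    avoided {v} (l , vl∈) = option (v , l)
      , (λ eq → mex∉ options (subst (_∈ options) eq (∈-map⁺ option vl∈)))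
      , nimberAcc-correct _ (rs (v , l , refl))
    avoid : ∀ {S′} → S ⟶ S′ → ∃ λ k → k ≢ mex options × HasNimber _⟶_ S′ k
    avoid (v , l , refl) = avoided (legalMoves-complete l)

  𝒢-correct : ∀ S → HasNimber _⟶_ S (𝒢 G S)
  𝒢-correct S = nimberAcc-correct S (⟶-wellFounded S)

-- Translations and multiplications on ℤ/m.

-- Subtraction of `s` modulo `m`. Because `∸` truncates, the inverse laws assume `s ≤ m`.
unshift : ∀ {m} → ℕ → Fin m → Fin m
unshift {m} s = shift (m ∸ s)

module _ {m : ℕ} .{{_ : NonZero m}} where

  %-absorbˡ-+ : ∀ a b → (a % m + b) % m ≡ (a + b) % m
  %-absorbˡ-+ a b = trans (%-distribˡ-+ (a % m) b m)
    (trans (cong (λ x → (x + b % m) % m) (m%n%n≡m%n a m)) (sym (%-distribˡ-+ a b m)))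

  %-absorbˡ-* : ∀ a b → (a % m * b) % m ≡ (a * b) % m
  %-absorbˡ-* a b = trans (%-distribˡ-* (a % m) b m)
    (trans (cong (λ x → (x * (b % m)) % m) (m%n%n≡m%n a m)) (sym (%-distribˡ-* a b m)))

  toℕ-mod : ∀ a → toℕ (a mod m) ≡ a % m
  toℕ-mod a = toℕ-fromℕ< (m%n<n a m)

  toℕ-shift : ∀ s (i : Fin m) → toℕ (shift s i) ≡ (toℕ i + s) % m
  toℕ-shift s i = toℕ-mod (toℕ i + s)

  shift-shift : ∀ a b (i : Fin m) → shift a (shift b i) ≡ shift (b + a) i
  shift-shift a b i = toℕ-injective (begin
    toℕ (shift a (shift b i))  ≡⟨ toℕ-shift a (shift b i) ⟩
    (toℕ (shift b i) + a) % m  ≡⟨ cong (λ x → (x + a) % m) (toℕ-shift b i) ⟩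
    ((toℕ i + b) % m + a) % m  ≡⟨ %-absorbˡ-+ (toℕ i + b) a ⟩
    (toℕ i + b + a) % m        ≡⟨ cong (_% m) (+-assoc (toℕ i) b a) ⟩
    (toℕ i + (b + a)) % m      ≡⟨ toℕ-shift (b + a) i ⟨
    toℕ (shift (b + a) i)      ∎)
    where open ≡-Reasoning

  shift-comm : ∀ a b (i : Fin m) → shift a (shift b i) ≡ shift b (shift a i)
  shift-comm a b i = trans (shift-shift a b i)
    (trans (cong (λ s → shift s i) (+-comm b a)) (sym (shift-shift b a i)))

  shift-m : ∀ (i : Fin m) → shift m i ≡ i
  shift-m i = toℕ-injective (trans (toℕ-shift m i)
    (trans ([m+n]%n≡m%n (toℕ i) m) (m<n⇒m%n≡m (toℕ<n i))))

  shift-unshift : ∀ {s} → s ≤ m → (i : Fin m) → shift s (unshift s i) ≡ i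
  shift-unshift {s} s≤m i = trans (shift-shift s (m ∸ s) i)
    (trans (cong (λ x → shift x i) (m∸n+n≡m s≤m)) (shift-m i))

  unshift-shift : ∀ {s} → s ≤ m → (i : Fin m) → unshift s (shift s i) ≡ i
  unshift-shift {s} s≤m i = trans (shift-comm (m ∸ s) s i) (shift-unshift s≤m i)

  shift-+-≢ : ∀ a {d} → 1 ≤ d → d < m → (i : Fin m) → shift (a + d) i ≢ shift a i
  shift-+-≢ a {d} 1≤d d<m i eq = shift-≢ d (shift a i) 1≤d d<m (trans (shift-shift d a i) eq)

  scale : ℕ → Fin m → Fin m
  scale c i = (toℕ i * c) mod m

  scale-scale : ∀ c d i → scale c (scale d i) ≡ scale (d * c) i
  scale-scale c d i = toℕ-injective (begin
    toℕ (scale c (scale d i))      ≡⟨ toℕ-mod _ ⟩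
    (toℕ (scale d i) * c) % m      ≡⟨ cong (λ x → (x * c) % m) (toℕ-mod _) ⟩
    ((toℕ i * d) % m * c) % m      ≡⟨ %-absorbˡ-* (toℕ i * d) c ⟩
    (toℕ i * d * c) % m            ≡⟨ cong (_% m) (*-assoc (toℕ i) d c) ⟩
    (toℕ i * (d * c)) % m          ≡⟨ toℕ-mod _ ⟨
    toℕ (scale (d * c) i)          ∎)
    where open ≡-Reasoning

  scale-id : ∀ {c} → c % m ≡ 1 % m → ∀ i → scale c i ≡ i
  scale-id {c} c≡1 i = toℕ-injective (begin
    toℕ (scale c i)            ≡⟨ toℕ-mod _ ⟩
    (toℕ i * c) % m            ≡⟨ %-distribˡ-* (toℕ i) c m ⟩
    (toℕ i % m * (c % m)) % m  ≡⟨ cong (λ x → (toℕ i % m * x) % m) c≡1 ⟩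
    (toℕ i % m * (1 % m)) % m  ≡⟨ %-distribˡ-* (toℕ i) 1 m ⟨
    (toℕ i * 1) % m            ≡⟨ cong (_% m) (*-identityʳ (toℕ i)) ⟩
    toℕ i % m                  ≡⟨ m<n⇒m%n≡m (toℕ<n i) ⟩
    toℕ i                      ∎)
    where open ≡-Reasoning

  scale-shift : ∀ c s i → scale c (shift s i) ≡ shift (s * c) (scale c i)
  scale-shift c s i = toℕ-injective (begin
    toℕ (scale c (shift s i))            ≡⟨ toℕ-mod _ ⟩
    (toℕ (shift s i) * c) % m            ≡⟨ cong (λ x → (x * c) % m) (toℕ-shift s i) ⟩
    ((toℕ i + s) % m * c) % m            ≡⟨ %-absorbˡ-* (toℕ i + s) c ⟩
    ((toℕ i + s) * c) % m                ≡⟨ cong (_% m) (*-distribʳ-+ c (toℕ i) s) ⟩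
    (toℕ i * c + s * c) % m              ≡⟨ %-absorbˡ-+ (toℕ i * c) (s * c) ⟨
    ((toℕ i * c) % m + s * c) % m        ≡⟨ cong (λ x → (x + s * c) % m) (toℕ-mod _) ⟨
    (toℕ (scale c i) + s * c) % m        ≡⟨ toℕ-shift (s * c) (scale c i) ⟨
    toℕ (shift (s * c) (scale c i))      ∎)
    where open ≡-Reasoning

-- The game on the cells of ℤ/m.

triple : ∀ {m} → ℕ → Fin m → List (Fin m)
triple s i = i ∷ shift s i ∷ unshift s i ∷ []

-- As for weights, true marks a dead cell.
Cells : ℕ → Set
Cells m = Fin m → Bool

-- On a live triple, disjunction agrees with switching; unlike switching it makes sense without
-- liveness and still commutes, as the mirror argument requires.
kill : ∀ {m} → ℕ → Fin m → Cells m → Cells m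
kill s i A j = A j ∨ does (member? Fin._≟_ j (triple s i))

_⊢_⟶_ : ∀ {m} → ℕ → Rel (Cells m) 0ℓ
s ⊢ A ⟶ A′ = ∃ λ i → (∀ {j} → j ∈ triple s i → A j ≡ false) × A′ ≡ kill s i A

allLive : ∀ {m} → Cells m
allLive _ = false

kill-∈ : ∀ {m} s (i : Fin m) A {j} → j ∈ triple s i → kill s i A j ≡ true
kill-∈ s i A {j} j∈ = trans (cong (A j ∨_) (dec-true (member? Fin._≟_ j _) j∈)) (∨-zeroʳ (A j))

kill-∉ : ∀ {m} s (i : Fin m) A {j} → j ∉ triple s i → kill s i A j ≡ A j
kill-∉ s i A {j} j∉ = trans (cong (A j ∨_) (dec-false (member? Fin._≟_ j _) j∉)) (∨-identityʳ (A j))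

-- Relabelling of cells and the mirror strategy.

module _ {m : ℕ} .{{_ : NonZero m}} where

  -- Used twice: with `f` and `g` both the mirror map and `s = t`, and with `f` the doubling map,
  -- `s = 1` and `t = 2`.
  module Equivariant {s t} (s≤m : s ≤ m) (t≤m : t ≤ m) (f g : Fin m → Fin m)
                     (g∘f : ∀ i → g (f i) ≡ i)
                     (f-shift : ∀ i → f (shift s i) ≡ shift t (f i)) where

    map-triple : ∀ i → map f (triple s i) ≡ triple t (f i)
    map-triple i = cong (f i ∷_) (cong₂ (λ x y → x ∷ y ∷ []) (f-shift i) f-unshift)
      where
      f-unshift : f (unshift s i) ≡ unshift t (f i)
      f-unshift = begin
        f (unshift s i)                        ≡⟨ unshift-shift t≤m _ ⟨
        unshift t (shift t (f (unshift s i)))  ≡⟨ cong (unshift t) (f-shift _) ⟨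
        unshift t (f (shift s (unshift s i)))  ≡⟨ cong (unshift t ∘ f) (shift-unshift s≤m i) ⟩
        unshift t (f i)                        ∎
        where open ≡-Reasoning

    triple⁺ : ∀ {i j} → j ∈ triple s i → f j ∈ triple t (f i)
    triple⁺ {i} {j} j∈ = subst (f j ∈_) (map-triple i) (∈-map⁺ f j∈)

    triple⁻ : ∀ {i j} → f j ∈ triple t (f i) → j ∈ triple s i
    triple⁻ {i} {j} fj∈ with ∈-map⁻ f (subst (f j ∈_) (sym (map-triple i)) fj∈)
    ... | x , x∈ , fj≡fx = subst (_∈ triple s i) (trans (sym (g∘f x)) (trans (cong g (sym fj≡fx)) (g∘f j))) x∈

    triple-does : ∀ i j → does (member? Fin._≟_ (f j) (triple t (f i))) ≡ does (member? Fin._≟_ j (triple s i))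
    triple-does i j = does-⇔ (mk⇔ (triple⁻ {i} {j}) (triple⁺ {i} {j})) (member? Fin._≟_ _ _) (member? Fin._≟_ _ _)

    module _ (f∘g : ∀ i → f (g i) ≡ i) where

      private
        _≈_ : Cells m → Cells m → Set
        A ≈ B = ∀ i → A i ≡ B (f i)

        kill-≈ : ∀ {A} B i → A ≈ B → kill s i A ≈ kill t (f i) B
        kill-≈ B i A≈B j = cong₂ _∨_ (A≈B j) (sym (triple-does i j))

      -- `A` is `B` pulled back along the bijection `f`, so a move at `i` corresponds to one at
      -- `f i`, and a move at `i` in `B` to one at `g i`.
      relabel : Bisimulation (s ⊢_⟶_) (t ⊢_⟶_) _≈_
      relabel = record
        { forth = λ { {A} {B} A≈B (i , live , refl) → kill t (f i) B
            , (f i , (λ {j} j∈ → subst (λ x → B x ≡ false) (f∘g j)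
                (trans (sym (A≈B (g j))) (live (triple⁻ (subst (_∈ triple t (f i)) (sym (f∘g j)) j∈)))) ) , refl)
            , kill-≈ B i A≈B }
        ; back = λ { {A} {B} A≈B (i , live , refl) → kill s (g i) A
            , (g i , (λ {j} j∈ → trans (A≈B j) (live (subst (λ x → f j ∈ triple t x) (f∘g i) (triple⁺ j∈)))) , refl)
            , subst (λ x → kill s (g i) A ≈ kill t x B) (f∘g i) (kill-≈ B (g i) A≈B) }
        }

  -- The second player answers each move with its mirror image under τ.
  mirror : ∀ {s} → s ≤ m → (τ : Fin m → Fin m) → (∀ i → τ (τ i) ≡ i) →
           (∀ i → τ (shift s i) ≡ shift s (τ i)) →
           (∀ {i j} → j ∈ triple s i → j ∉ triple s (τ i)) →
           ∀ {A n} → (∀ j → A (τ j) ≡ A j) → HasNimber (s ⊢_⟶_) A n → n ≡ 0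
  mirror {s} s≤m τ ττ τ-shift disjoint = go
    where
    open Equivariant s≤m s≤m τ τ ττ τ-shift
    hit : Fin m → Fin m → Bool
    hit i j = does (member? Fin._≟_ j (triple s i))
    hit-τ : ∀ i j → hit i (τ j) ≡ hit (τ i) j
    hit-τ i j = trans (cong (λ x → hit x (τ j)) (sym (ττ i))) (triple-does (τ i) j)
    A″ : Cells m → Fin m → Cells m
    A″ A i = kill s (τ i) (kill s i A)
    -- `τ` exchanges the two killed triples, so move and reply together restore the symmetry.
    A″-sym : ∀ {A} i → (∀ j → A (τ j) ≡ A j) → ∀ j → A″ A i (τ j) ≡ A″ A i j
    A″-sym {A} i A-sym j = begin
      (A (τ j) ∨ hit i (τ j)) ∨ hit (τ i) (τ j)  ≡⟨ cong₂ (λ x y → (A (τ j) ∨ x) ∨ y) (hit-τ i j) (triple-does i j) ⟩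
      (A (τ j) ∨ hit (τ i) j) ∨ hit i j          ≡⟨ cong (λ x → (x ∨ hit (τ i) j) ∨ hit i j) (A-sym j) ⟩
      (A j ∨ hit (τ i) j) ∨ hit i j              ≡⟨ ∨-assoc (A j) _ _ ⟩
      A j ∨ (hit (τ i) j ∨ hit i j)              ≡⟨ cong (A j ∨_) (∨-comm (hit (τ i) j) (hit i j)) ⟩
      A j ∨ (hit i j ∨ hit (τ i) j)              ≡⟨ ∨-assoc (A j) _ _ ⟨
      (A j ∨ hit i j) ∨ hit (τ i) j              ∎
      where open ≡-Reasoning
    -- The reply is legal: its triple was live by symmetry, and the first move misses it by
    -- disjointness.
    live-τ : ∀ {A} i → (∀ j → A (τ j) ≡ A j) → (∀ {j} → j ∈ triple s i → A j ≡ false) →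
             ∀ {j} → j ∈ triple s (τ i) → kill s i A j ≡ false
    live-τ {A} i A-sym live {j} j∈ = trans (kill-∉ s i A λ j∈i → disjoint j∈i j∈)
      (trans (sym (A-sym j)) (live (subst (λ x → τ j ∈ triple s x) (ττ i) (triple⁺ {τ i} {j} j∈))))
    go : ∀ {A n} → (∀ j → A (τ j) ≡ A j) → HasNimber (s ⊢_⟶_) A n → n ≡ 0
    go {n = zero} _ _ = refl
    go {A} {n = suc _} A-sym (hasNimber below _) with below (s≤s z≤n)
    -- A positive nimber would provide an option of nimber 0. Its mirror reply has nonzero nimber,
    -- but is symmetric again, so by induction its nimber is 0.
    ... | _ , (i , live , refl) , hasNimber _ avoid with avoid (τ i , live-τ i A-sym live , refl)
    ...   | k , k≢0 , A″:k = contradiction (go (A″-sym i A-sym) A″:k) k≢0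

-- Even m: both cell games have nimber 0.

-- Shifting by 1 turns the offsets 0, 1, −1 into natural numbers.
∈triple⇒shifts : ∀ {m} .{{_ : NonZero m}} → 1 ≤ m →
                 ∀ {i j : Fin m} → j ∈ triple 1 i → ∃ λ c → c ≤ 2 × shift 1 j ≡ shift c i
∈triple⇒shifts 1≤m {i} (here refl) = 1 , s≤s z≤n , refl
∈triple⇒shifts 1≤m {i} (there (here refl)) = 2 , ℕ.≤-refl , shift-shift 1 1 i
∈triple⇒shifts {m} 1≤m {i} (there (there (here refl))) =
  -- `shift 0` is not definitionally the identity; the law comes from `unshift 0`, which is
  -- `shift m`.
  0 , z≤n , trans (shift-unshift 1≤m i) (trans (sym (shift-unshift z≤n i)) (cong (shift 0) (shift-m i)))

-- A common cell would give i + c = i + h + c′ with c and c′ at most 2. Since h ≥ 3, the difference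
-- h + c′ - c lies strictly between 0 and 2h.
antipodal-disjoint : ∀ {h} .{{_ : NonZero (h + h)}} → 3 ≤ h →
                     ∀ {i j : Fin (h + h)} → j ∈ triple 1 i → j ∉ triple 1 (shift h i)
antipodal-disjoint {h} 3≤h {i} {j} j∈ j∈′
  with ∈triple⇒shifts 1≤2h j∈ | ∈triple⇒shifts 1≤2h j∈′
  where
  1≤2h : 1 ≤ h + h
  1≤2h = ≤-trans (s≤s z≤n) (≤-trans 3≤h (ℕ.m≤m+n h h))
... | c , c≤2 , eq | c′ , c′≤2 , eq′ = shift-+-≢ c {h + c′ ∸ c} (ℕ.m<n⇒0<n∸m c<) d< i (begin
    shift (c + (h + c′ ∸ c)) i  ≡⟨ cong (λ x → shift x i) (m+[n∸m]≡n (ℕ.<⇒≤ c<)) ⟩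
    shift (h + c′) i            ≡⟨ shift-shift c′ h i ⟨
    shift c′ (shift h i)        ≡⟨ eq′ ⟨
    shift 1 j                   ≡⟨ eq ⟩
    shift c i                   ∎)
  where
  open ≡-Reasoning
  c< : c < h + c′
  c< = ≤-trans (s≤s c≤2) (≤-trans 3≤h (ℕ.m≤m+n h c′))
  d< : h + c′ ∸ c < h + h
  d< = ℕ.≤-<-trans (ℕ.m∸n≤m (h + c′) c) (ℕ.+-monoʳ-< h (≤-trans (s≤s c′≤2) 3≤h))

module _ {h : ℕ} .{{_ : NonZero (h + h)}} (3≤h : 3 ≤ h) where

  private
    m : ℕ
    m = h + h

    h≤m : h ≤ m
    h≤m = ℕ.m≤m+n h h

    1≤m : 1 ≤ m
    1≤m = ≤-trans (s≤s z≤n) (≤-trans 3≤h h≤m)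

    2≤m : 2 ≤ m
    2≤m = ≤-trans (s≤s (s≤s z≤n)) (≤-trans 3≤h h≤m)

  triple₁-even : ∀ {n} → HasNimber (1 ⊢_⟶_) (allLive {m}) n → n ≡ 0
  triple₁-even = mirror 1≤m (shift h)
    (λ i → trans (shift-shift h h i) (shift-m i)) (shift-comm h 1) (antipodal-disjoint 3≤h) (λ _ → refl)

  private
    parity : Fin m → ℕ
    parity i = toℕ i % 2

    2∣m : 2 ∣ m
    2∣m = divides h (trans (cong (h +_) (sym (ℕ.+-identityʳ h))) (*-comm 2 h))

    parity-shift : ∀ s i → parity (shift s i) ≡ (parity i + s) % 2
    parity-shift s i = begin
      toℕ (shift s i) % 2    ≡⟨ cong (_% 2) (toℕ-shift s i) ⟩
      (toℕ i + s) % m % 2    ≡⟨ m∣n⇒o%n%m≡o%m 2 m (toℕ i + s) 2∣m ⟩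
      (toℕ i + s) % 2        ≡⟨ %-absorbˡ-+ (toℕ i) s ⟨
      (toℕ i % 2 + s) % 2    ∎
      where open ≡-Reasoning

    parity-shift₂ : ∀ i → parity (shift 2 i) ≡ parity i
    parity-shift₂ i = trans (parity-shift 2 i) (trans ([m+n]%n≡m%n (parity i) 2) (m%n%n≡m%n (toℕ i) 2))

    -- As `m` is even, steps of 2 stay within a parity class. A mirror map that exchanges the
    -- classes therefore separates a triple from its image.
    parity-triple : ∀ {i j} → j ∈ triple 2 i → parity j ≡ parity i
    parity-triple (here refl) = refl
    parity-triple {i} (there (here refl)) = parity-shift₂ i
    parity-triple {i} (there (there (here refl))) =
      trans (sym (parity-shift₂ (unshift 2 i))) (cong parity (shift-unshift 2≤m i))

    parity-cases : ∀ i → parity i ≡ 0 ⊎ parity i ≡ 1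
    parity-cases i = cases (parity i) (m%n<n (toℕ i) 2)
      where
      cases : ∀ p → p < 2 → p ≡ 0 ⊎ p ≡ 1
      cases 0 _ = inj₁ refl
      cases 1 _ = inj₂ refl
      cases (suc (suc _)) (s≤s (s≤s ()))

    -- The parity is a separate argument, so that equations between parities can be applied by
    -- `cong`.
    toward : ℕ → Fin m → Fin m
    toward 0 = shift 1
    toward (suc _) = unshift 1

    -- Exchanges 2j and 2j + 1.
    swapPair : Fin m → Fin m
    swapPair i = toward (parity i) i

    parity-unshift : ∀ i → parity i ≡ 1 → parity (unshift 1 i) ≡ 0
    parity-unshift i p with parity-cases (unshift 1 i)
    ... | inj₁ q = q
    ... | inj₂ q = contradiction (trans (sym p) (trans (cong parity (sym (shift-unshift 1≤m i)))
            (trans (parity-shift 1 (unshift 1 i)) (cong (λ x → (x + 1) % 2) q)))) λ ()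

    parity-shift₁ : ∀ i → parity i ≡ 0 → parity (shift 1 i) ≡ 1
    parity-shift₁ i p = trans (parity-shift 1 i) (cong (λ x → (x + 1) % 2) p)

    swapPair-even : ∀ {i} → parity i ≡ 0 → swapPair i ≡ shift 1 i
    swapPair-even {i} p = cong (λ q → toward q i) p

    swapPair-odd : ∀ {i} → parity i ≡ 1 → swapPair i ≡ unshift 1 i
    swapPair-odd {i} p = cong (λ q → toward q i) p

    swapPair-involutive : ∀ i → swapPair (swapPair i) ≡ i
    swapPair-involutive i with parity-cases i
    ... | inj₁ p = trans (cong swapPair (swapPair-even p))
                     (trans (swapPair-odd (parity-shift₁ i p)) (unshift-shift 1≤m i))
    ... | inj₂ p = trans (cong swapPair (swapPair-odd p))
                     (trans (swapPair-even (parity-unshift i p)) (shift-unshift 1≤m i))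

    toward-shift : ∀ p s i → toward p (shift s i) ≡ shift s (toward p i)
    toward-shift 0 s i = shift-comm 1 s i
    toward-shift (suc _) s i = shift-comm (m ∸ 1) s i

    swapPair-shift : ∀ i → swapPair (shift 2 i) ≡ shift 2 (swapPair i)
    swapPair-shift i = trans (cong (λ p → toward p (shift 2 i)) (parity-shift₂ i)) (toward-shift (parity i) 2 i)

    parity-swapPair : ∀ i → parity i ≢ parity (swapPair i)
    parity-swapPair i eq with parity-cases i
    ... | inj₁ p = contradiction (trans (sym p) (trans eq (trans (cong parity (swapPair-even p)) (parity-shift₁ i p)))) λ ()
    ... | inj₂ p = contradiction (trans (sym p) (trans eq (trans (cong parity (swapPair-odd p)) (parity-unshift i p)))) λ ()

  triple₂-even : ∀ {n} → HasNimber (2 ⊢_⟶_) (allLive {m}) n → n ≡ 0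
  triple₂-even = mirror 2≤m swapPair swapPair-involutive swapPair-shift
    (λ {i} j∈ j∈′ → parity-swapPair i (trans (sym (parity-triple j∈)) (parity-triple j∈′))) (λ _ → refl)

-- Odd m: doubling carries step 1 to step 2.

-- Here m = 2h + 3, and 2(h + 2) = m + 1, so multiplication by h + 2 inverts doubling.
triple-odd : ∀ h {n} → HasNimber (1 ⊢_⟶_) (allLive {suc (suc h + suc h)}) n →
             HasNimber (2 ⊢_⟶_) (allLive {suc (suc h + suc h)}) n
triple-odd h = Bisimulation.transport (relabel (λ i → trans (scale-scale 2 (2 + h) i) (scale-id 2[h+2]≡1 i))) (λ _ → refl)
  where
  m : ℕ
  m = suc (suc h + suc h)
  2[h+2]≡1 : ((2 + h) * 2) % m ≡ 1 % m
  2[h+2]≡1 = trans (cong (_% m) eq) ([m+n]%n≡m%n 1 m)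
    where
    eq : (2 + h) * 2 ≡ 1 + m
    eq = trans (*-comm (2 + h) 2) (cong (2 +_) (trans (cong (h +_) (cong (2 +_) (ℕ.+-identityʳ h)))
      (trans (ℕ.+-suc h (suc h)) refl)))
  open Equivariant {m} {1} {2} (s≤s z≤n) (s≤s (s≤s z≤n)) (scale 2) (scale (2 + h))
    (λ i → trans (scale-scale (2 + h) 2 i) (scale-id (trans (cong (_% m) (*-comm 2 (2 + h))) 2[h+2]≡1) i))
    (scale-shift 2 1)

even⊎odd : ∀ m → (∃ λ h → m ≡ h + h) ⊎ (∃ λ h → m ≡ suc (h + h))
even⊎odd zero = inj₁ (0 , refl)
even⊎odd (suc m) with even⊎odd m
... | inj₁ (h , refl) = inj₂ (h , refl)
... | inj₂ (h , refl) = inj₁ (suc h , cong suc (sym (ℕ.+-suc h h)))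

triple₁≡triple₂ : ∀ {m a b} → 5 ≤ m → HasNimber (1 ⊢_⟶_) (allLive {m}) a →
                  HasNimber (2 ⊢_⟶_) (allLive {m}) b → a ≡ b
triple₁≡triple₂ {m} 5≤m p q with even⊎odd m
-- The small cases contradict `5 ≤ m`; even `m` is then at least 6, which gives the half-length 3
-- needed for antipodal triples.
triple₁≡triple₂ () p q | inj₁ (0 , refl)
triple₁≡triple₂ (s≤s (s≤s ())) p q | inj₁ (1 , refl)
triple₁≡triple₂ (s≤s (s≤s (s≤s (s≤s ())))) p q | inj₁ (2 , refl)
... | inj₁ (suc (suc (suc h)) , refl) = trans (triple₁-even {3 + h} 3≤ p) (sym (triple₂-even {3 + h} 3≤ q))
  where
  3≤ : 3 ≤ 3 + h
  3≤ = s≤s (s≤s (s≤s z≤n))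
triple₁≡triple₂ (s≤s ()) p q | inj₂ (0 , refl)
... | inj₂ (suc h , refl) = HasNimber-unique (triple-odd h p) q

-- Rows, closed neighbourhoods and legal moves in P(m,k).

other : Fin 2 → Fin 2
other zero = suc zero
other (suc zero) = zero

other-involutive : ∀ r → other (other r) ≡ r
other-involutive zero = refl
other-involutive (suc zero) = refl

other-≢ : ∀ r → r ≢ other r
other-≢ zero ()
other-≢ (suc zero) ()

row-cases : ∀ r r′ → r′ ≡ r ⊎ r′ ≡ other r
row-cases zero zero = inj₁ refl
row-cases zero (suc zero) = inj₂ refl
row-cases (suc zero) zero = inj₂ refl
row-cases (suc zero) (suc zero) = inj₁ refl

private
  count : Bool → ℕ
  count b = if b then 0 else 1

  total : Bool → Bool → Bool → Bool → ℕ
  total a b c d = sum (count a ∷ count b ∷ count c ∷ count d ∷ [])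

  count≡1 : ∀ b → count b ≡ 1 → b ≡ false
  count≡1 false _ = refl

  -- Switching turns a weight sum w of four vertices into 4 - w, which is smaller only if w ≥ 3.
  -- With `d` dead, the other three must all be live.
  lowering⇒live : ∀ {a} b c {d} → d ≡ true → a ≡ false →
                  total (not a) (not b) (not c) (not d) < total a b c d →
                  b ≡ false × c ≡ false
  lowering⇒live false false refl refl _ = refl , refl
  lowering⇒live false true  refl refl (s≤s (s≤s ()))
  lowering⇒live true  false refl refl (s≤s (s≤s ()))
  lowering⇒live true  true  refl refl (s≤s ())

  live⇒lowering : ∀ {a b c} d → a ≡ false → b ≡ false → c ≡ false →
                  total (not a) (not b) (not c) (not d) < total a b c d
  live⇒lowering true  refl refl refl = s≤s (s≤s z≤n)
  live⇒lowering false refl refl refl = s≤s z≤n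

step : ℕ → Fin 2 → ℕ
step k zero = k
step k (suc zero) = 1

⌊n/2⌋+⌊n/2⌋≤n : ∀ n → ⌊ n /2⌋ + ⌊ n /2⌋ ≤ n
⌊n/2⌋+⌊n/2⌋≤n n = ≤-trans (ℕ.+-monoʳ-≤ ⌊ n /2⌋ (ℕ.⌊n/2⌋≤⌈n/2⌉ n)) (ℕ.≤-reflexive (ℕ.⌊n/2⌋+⌈n/2⌉≡n n))

module _ {m k : ℕ} .{{_ : NonZero m}} (1≤k : 1 ≤ k) (k≤ : k ≤ ⌊ m ∸ 1 /2⌋) where

  open FiniteSimpleGraph (petersen m k 1≤k k≤)
  open Toggle (petersen m k 1≤k k≤) hiding (Position; 𝒢)

  private
    _⇀_ : Fin 2 → Fin m → Fin m
    r ⇀ i = shift (step k r) i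

    _↽_ : Fin 2 → Fin m → Fin m
    r ↽ i = unshift (step k r) i

    1≤step : ∀ r → 1 ≤ step k r
    1≤step zero = 1≤k
    1≤step (suc zero) = s≤s z≤n

    step≤k : ∀ r → step k r ≤ k
    step≤k zero = ℕ.≤-refl
    step≤k (suc zero) = 1≤k

    -- From 2k ≤ m - 1. It keeps the two row neighbours of a vertex distinct, so that closed
    -- neighbourhoods have four vertices.
    k+k<m : k + k < m
    k+k<m = ≤-trans (s≤s (≤-trans (ℕ.+-mono-≤ k≤ k≤) (⌊n/2⌋+⌊n/2⌋≤n (m ∸ 1)))) (ℕ.≤-reflexive (ℕ.suc-pred m))

    step+step<m : ∀ r → step k r + step k r < m
    step+step<m r = ℕ.≤-<-trans (ℕ.+-mono-≤ (step≤k r) (step≤k r)) k+k<m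

    step<m : ∀ r → step k r < m
    step<m r = ℕ.≤-<-trans (ℕ.m≤m+n (step k r) (step k r)) (step+step<m r)

    ⇀↽ : ∀ r i → r ⇀ (r ↽ i) ≡ i
    ⇀↽ r = shift-unshift (ℕ.<⇒≤ (step<m r))

    ↽⇀ : ∀ r i → r ↽ (r ⇀ i) ≡ i
    ↽⇀ r = unshift-shift (ℕ.<⇒≤ (step<m r))

    ⇀-≢ : ∀ r i → r ⇀ i ≢ i
    ⇀-≢ r i = shift-≢ (step k r) i (1≤step r) (step<m r)

    ⇀⇀-≢ : ∀ r i → r ⇀ (r ⇀ i) ≢ i
    ⇀⇀-≢ r i eq = shift-≢ (step k r + step k r) i (≤-trans (1≤step r) (ℕ.m≤m+n _ _)) (step+step<m r)
      (trans (sym (shift-shift (step k r) (step k r) i)) eq)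

  nbhd : Fin 2 → Fin m → List Vertex
  nbhd r i = (r , i) ∷ (r , r ⇀ i) ∷ (r , r ↽ i) ∷ (other r , i) ∷ []

  ∈N⇒∈nbhd : ∀ {u r i} → u ∈N[ r , i ] → u ∈ nbhd r i
  ∈N⇒∈nbhd (inj₁ refl) = here refl
  ∈N⇒∈nbhd (inj₂ (inj₁ (outerEdge i))) = there (here refl)
  ∈N⇒∈nbhd (inj₂ (inj₁ (innerEdge i))) = there (here refl)
  ∈N⇒∈nbhd (inj₂ (inj₁ (spoke i))) = there (there (there (here refl)))
  ∈N⇒∈nbhd (inj₂ (inj₂ (outerEdge i))) = there (there (here (cong (suc zero ,_) (sym (↽⇀ (suc zero) i)))))
  ∈N⇒∈nbhd (inj₂ (inj₂ (innerEdge i))) = there (there (here (cong (zero ,_) (sym (↽⇀ zero i)))))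
  ∈N⇒∈nbhd (inj₂ (inj₂ (spoke i))) = there (there (there (here refl)))

  private
    edge : ∀ r i → PetersenEdge {m} k (r , i) (r , r ⇀ i)
    edge zero = innerEdge
    edge (suc zero) = outerEdge

    rung : ∀ r i → Adj (r , i) (other r , i)
    rung zero i = inj₁ (spoke i)
    rung (suc zero) i = inj₂ (spoke i)

  ∈nbhd⇒∈N : ∀ {u r i} → u ∈ nbhd r i → u ∈N[ r , i ]
  ∈nbhd⇒∈N (here refl) = inj₁ refl
  ∈nbhd⇒∈N {r = r} {i} (there (here refl)) = inj₂ (inj₁ (edge r i))
  ∈nbhd⇒∈N {r = r} {i} (there (there (here refl))) =
    inj₂ (inj₂ (subst (λ x → PetersenEdge k (r , r ↽ i) (r , x)) (⇀↽ r i) (edge r (r ↽ i))))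
  ∈nbhd⇒∈N {r = r} {i} (there (there (there (here refl)))) = inj₂ (rung r i)

  nbhd-unique : ∀ r i → Unique (nbhd r i)
  nbhd-unique r i =
      ((λ eq → ⇀-≢ r i (sym (cong proj₂ eq))) ∷ (λ eq → ↽-≢ (cong proj₂ eq)) ∷ (λ eq → other-≢ r (cong proj₁ eq)) ∷ [])
    ∷ ((λ eq → ⇀-≢-↽ (cong proj₂ eq)) ∷ (λ eq → other-≢ r (cong proj₁ eq)) ∷ [])
    ∷ ((λ eq → other-≢ r (cong proj₁ eq)) ∷ [])
    ∷ [] ∷ []
    where
    ↽-≢ : i ≢ r ↽ i
    ↽-≢ eq = ⇀-≢ r i (trans (cong (r ⇀_) eq) (⇀↽ r i))
    ⇀-≢-↽ : r ⇀ i ≢ r ↽ i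
    ⇀-≢-↽ eq = ⇀⇀-≢ r i (trans (cong (r ⇀_) eq) (⇀↽ r i))

  -- The filtered vertex list and `nbhd r i` are duplicate-free with the same members, hence
  -- permutations of each other.
  σ-nbhd : ∀ S r i → σ S (r , i) ≡ total (S (r , i)) (S (r , r ⇀ i)) (S (r , r ↽ i)) (S (other r , i))
  σ-nbhd S r i = sum-↭ (map⁺ (weight S) (∼bag⇒↭ (unique∧set⇒bag
    (filter⁺ (_∈N[ r , i ]?) unique) (nbhd-unique r i)
    (λ {u} → mk⇔ (λ u∈ → ∈N⇒∈nbhd (proj₂ (∈-filter⁻ (_∈N[ r , i ]?) {xs = vertices} u∈)))
                 (λ u∈ → ∈-filter⁺ (_∈N[ r , i ]?) (complete u) (∈nbhd⇒∈N u∈))))))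

  switch-∈ : ∀ S r i {u} → u ∈ nbhd r i → switch (r , i) S u ≡ not (S u)
  switch-∈ S r i {u} u∈ = cong (λ b → if b then not (S u) else S u)
    (dec-true (u ∈N[ r , i ]?) (∈nbhd⇒∈N u∈))

  switch-∉ : ∀ S r i {u} → u ∉ nbhd r i → switch (r , i) S u ≡ S u
  switch-∉ S r i {u} u∉ = cong (λ b → if b then not (S u) else S u)
    (dec-false (u ∈N[ r , i ]?) (λ u∈ → u∉ (∈N⇒∈nbhd u∈)))

  σ-switch : ∀ S r i → σ (switch (r , i) S) (r , i) ≡
             total (not (S (r , i))) (not (S (r , r ⇀ i))) (not (S (r , r ↽ i))) (not (S (other r , i)))
  σ-switch S r i = trans (σ-nbhd (switch (r , i) S) r i)
    (trans (cong₂ (λ a b → total a b (S′ (r , r ↽ i)) (S′ (other r , i)))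
              (switch-∈ S r i (here refl)) (switch-∈ S r i (there (here refl))))
           (cong₂ (total (not (S (r , i))) (not (S (r , r ⇀ i))))
              (switch-∈ S r i (there (there (here refl)))) (switch-∈ S r i (there (there (there (here refl)))))))
    where
    S′ : Vertex → Bool
    S′ = switch (r , i) S

  LiveTriple : (Vertex → Bool) → Fin 2 → Fin m → Set
  LiveTriple S r i = ∀ {j} → j ∈ triple (step k r) i → S (r , j) ≡ false

  legal⇒live : ∀ {S r i} → Legal S (r , i) → S (r , i) ≡ false
  legal⇒live {S} {r} {i} (w≡1 , _) = count≡1 (S (r , i)) w≡1

  legal⇒LiveTriple : ∀ {S r i} → Legal S (r , i) → S (other r , i) ≡ true → LiveTriple S r i
  legal⇒LiveTriple {S} {r} {i} l@(_ , σ<σ) rung-dead with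
    lowering⇒live (S (r , r ⇀ i)) (S (r , r ↽ i)) rung-dead (legal⇒live l) (subst₂ _<_ (σ-switch S r i) (σ-nbhd S r i) σ<σ)
  ... | b , c = λ { (here refl) → legal⇒live l
                  ; (there (here refl)) → b
                  ; (there (there (here refl))) → c }

  LiveTriple⇒legal : ∀ {S r i} → LiveTriple S r i → Legal S (r , i)
  LiveTriple⇒legal {S} {r} {i} lives = cong count (lives (here refl)) ,
    subst₂ _<_ (sym (σ-switch S r i)) (sym (σ-nbhd S r i))
      (live⇒lowering (S (other r , i)) (lives (here refl)) (lives (there (here refl))) (lives (there (there (here refl)))))

  -- Coupling Toggle positions with cell positions.

  module _ (r : Fin 2) where

    private
      o : Fin 2
      o = other r

      dead : ∀ {b} → b ≢ false → b ≡ true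
      dead = ¬-not


    -- Triples whose centres are one or two steps apart meet. Revived vertices sit opposite the
    -- centres of disjoint triples, so these distances do not occur among them.
    Separated : (Fin m → Bool) → Set
    Separated Q = ∀ i → Q i ≡ false → Q (r ⇀ i) ≡ true × Q (r ⇀ (r ⇀ i)) ≡ true

    -- A live vertex of the other row records a move at its neighbour in row r.
    record Coupled (S : Vertex → Bool) (A : Cells m) : Set where
      field
        agree     : ∀ i → S (r , i) ≡ A i
        covered   : ∀ {i j} → S (o , i) ≡ false → j ∈ triple (step k r) i → S (r , j) ≡ true
        separated : Separated (λ i → S (o , i))

    module _ {S A i} (C : Coupled S A) (A-live : ∀ {j} → j ∈ triple (step k r) i → A j ≡ false) where

      open Coupled C

      private
        S′ : Vertex → Bool
        S′ = switch (r , i) S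

        row⁺ : ∀ {j} → j ∈ triple (step k r) i → (r , j) ∈ nbhd r i
        row⁺ (here refl) = here refl
        row⁺ (there (here refl)) = there (here refl)
        row⁺ (there (there (here refl))) = there (there (here refl))

        row⁻ : ∀ {j} → (r , j) ∈ nbhd r i → j ∈ triple (step k r) i
        row⁻ (here eq) = here (cong proj₂ eq)
        row⁻ (there (here eq)) = there (here (cong proj₂ eq))
        row⁻ (there (there (here eq))) = there (there (here (cong proj₂ eq)))
        row⁻ (there (there (there (here eq)))) = contradiction (cong proj₁ eq) (other-≢ r)

        rung⁻ : ∀ {j} → (o , j) ∈ nbhd r i → j ≡ i
        rung⁻ (here eq) = contradiction (sym (cong proj₁ eq)) (other-≢ r)
        rung⁻ (there (here eq)) = contradiction (sym (cong proj₁ eq)) (other-≢ r)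
        rung⁻ (there (there (here eq))) = contradiction (sym (cong proj₁ eq)) (other-≢ r)
        rung⁻ (there (there (there (here eq)))) = cong proj₂ eq

        S-live : ∀ {j} → j ∈ triple (step k r) i → S (r , j) ≡ false
        S-live {j} j∈ = trans (agree j) (A-live j∈)

        -- The triple at `i` is still live, whereas `covered` makes the triple of a revived vertex
        -- dead.
        disjoint : ∀ {x j} → j ∈ triple (step k r) i → j ∈ triple (step k r) x → S (o , x) ≢ false
        disjoint j∈i j∈x x-live = not-¬ (covered x-live j∈x) (S-live j∈i)

        hit : ∀ {j} → j ∈ triple (step k r) i → S′ (r , j) ≡ true
        hit j∈ = trans (switch-∈ S r i (row⁺ j∈)) (cong not (S-live j∈))

        missed : ∀ {j} → j ∉ triple (step k r) i → S′ (r , j) ≡ S (r , j)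
        missed j∉ = switch-∉ S r i (λ j∈ → j∉ (row⁻ j∈))

        kept : ∀ {j} → j ≢ i → S′ (o , j) ≡ S (o , j)
        kept j≢i = switch-∉ S r i (λ j∈ → j≢i (rung⁻ j∈))

        agree′ : ∀ j → S′ (r , j) ≡ kill (step k r) i A j
        agree′ j with member? Fin._≟_ j (triple (step k r) i)
        ... | yes j∈ = trans (hit j∈) (sym (kill-∈ (step k r) i A j∈))
        ... | no j∉ = trans (missed j∉) (trans (agree j) (sym (kill-∉ (step k r) i A j∉)))

        covered′ : ∀ {x j} → S′ (o , x) ≡ false → j ∈ triple (step k r) x → S′ (r , j) ≡ true
        covered′ {x} {j} x-live j∈ with x Fin.≟ i
        ... | yes refl = hit j∈
        ... | no x≢i = trans (missed (λ j∈i → disjoint j∈i j∈ x-live′)) (covered x-live′ j∈)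
          where
          x-live′ : S (o , x) ≡ false
          x-live′ = trans (sym (kept x≢i)) x-live

        ⇀∈triple⇀⇀ : ∀ x → (r ⇀ x) ∈ triple (step k r) (r ⇀ (r ⇀ x))
        ⇀∈triple⇀⇀ x = there (there (here (sym (↽⇀ r (r ⇀ x)))))

        -- Only pairs involving the newly revived `i` are new. One or two steps apart, their triples
        -- would share a cell, against `disjoint`; the two cases treat `i` as the earlier and as the
        -- later cell.
        separated′ : Separated (λ j → S′ (o , j))
        separated′ x x-live with x Fin.≟ i
        ... | yes refl =
            trans (kept (⇀-≢ r i)) (dead (disjoint (there (here refl)) (here refl)))
          , trans (kept (⇀⇀-≢ r i)) (dead (disjoint (there (here refl)) (⇀∈triple⇀⇀ i)))
        ... | no x≢i =
            trans (kept λ eq → disjoint (here refl) (there (here (sym eq))) x-live′) (proj₁ (separated x x-live′))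
          , trans (kept λ eq → disjoint (subst (λ y → (r ⇀ x) ∈ triple (step k r) y) eq (⇀∈triple⇀⇀ x)) (there (here refl)) x-live′)
              (proj₂ (separated x x-live′))
          where
          x-live′ : S (o , x) ≡ false
          x-live′ = trans (sym (kept x≢i)) x-live

      Coupled-move : Coupled S′ (kill (step k r) i A)
      Coupled-move = record { agree = agree′ ; covered = covered′ ; separated = separated′ }

    -- The two steps interact here: `Separated` is measured in the step of row `r`, while a move in
    -- the other row needs a live triple in that row's own step.
    module _ (blocked : ∀ Q → Separated Q → ∀ i → ¬ (∀ {j} → j ∈ triple (step k o) i → Q j ≡ false)) where

      private
        module _ {S A} (C : Coupled S A) where
          open Coupled C

          -- A live vertex of the other row has a dead opposite by `covered`, so a legal move there
          -- would need a whole live triple, which `blocked` excludes.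
          unplayable : ∀ i → ¬ Legal S (o , i)
          unplayable i l = blocked (λ j → S (o , j)) separated i
            (legal⇒LiveTriple l (subst (λ x → S (x , i) ≡ true) (sym (other-involutive r)) (covered (legal⇒live l) (here refl))))

          -- The opposite vertex is dead, since `covered` would otherwise make the chosen vertex
          -- dead; legality then forces the full triple.
          playable : ∀ i → Legal S (r , i) → ∀ {j} → j ∈ triple (step k r) i → A j ≡ false
          playable i l {j} j∈ = trans (sym (agree j))
            (legal⇒LiveTriple l (dead λ o-live → not-¬ (covered o-live (here refl)) (legal⇒live l)) j∈)

          coupled-forth : ∀ {S′} → S ⟶ S′ → ∃ λ A′ → (step k r ⊢ A ⟶ A′) × Coupled S′ A′
          coupled-forth ((r′ , i) , l , refl) with row-cases r r′
          ... | inj₁ refl = kill (step k r) i A , (i , playable i l , refl) , Coupled-move C (playable i l)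
          ... | inj₂ refl = ⊥-elim (unplayable i l)

          coupled-back : ∀ {A′} → step k r ⊢ A ⟶ A′ → ∃ λ S′ → S ⟶ S′ × Coupled S′ A′
          coupled-back (i , A-live , refl) = switch (r , i) S
            , ((r , i) , LiveTriple⇒legal (λ {j} j∈ → trans (agree j) (A-live j∈)) , refl)
            , Coupled-move C A-live

      nimber-row : ∀ S → (∀ i → S (r , i) ≡ false) → (∀ i → S (o , i) ≡ true) →
                   HasNimber (step k r ⊢_⟶_) allLive (𝒢 (petersen m k 1≤k k≤) S)
      nimber-row S r-live o-dead = Bisimulation.transport
        (record { forth = λ C → coupled-forth C ; back = λ C → coupled-back C })
        (record { agree = r-live
                -- Nothing has been revived at the start, so both conditions hold vacuously.
                ; covered = λ {i} live → ⊥-elim (not-¬ (o-dead i) live)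
                ; separated = λ i live → ⊥-elim (not-¬ (o-dead i) live) })
        (𝒢-correct (petersen m k 1≤k k≤) S)

-- The four starting positions as cell games.

theorem4p16 : (m : ℕ) (5≤m : 5 ≤ m) →
    let P[m,1] = petersen m 1 (s≤s z≤n) (1≤⌊m-1/2⌋ 5≤m)
        P[m,2] = petersen m 2 (s≤s z≤n) (2≤⌊m-1/2⌋ 5≤m)
    in 𝒢 P[m,1] 𝒫₀₁ ≡ 𝒢 P[m,1] 𝒫₁₀
     × 𝒢 P[m,1] 𝒫₁₀ ≡ 𝒢 P[m,2] 𝒫₀₁
     × 𝒢 P[m,2] 𝒫₀₁ ≡ 𝒢 P[m,2] 𝒫₁₀
theorem4p16 m@(suc _) 5≤m =
    HasNimber-unique outer₁ inner₁
  , HasNimber-unique inner₁ outer₂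
  , triple₁≡triple₂ 5≤m outer₂ inner₂
  where
  1≤m : 1 ≤ m
  1≤m = ≤-trans (s≤s z≤n) 5≤m
  outer₁ : HasNimber (1 ⊢_⟶_) allLive (𝒢 (petersen m 1 (s≤s z≤n) (1≤⌊m-1/2⌋ 5≤m)) 𝒫₀₁)
  -- Both rows have step 1: a live triple contains i and i + 1, one step apart.
  outer₁ = nimber-row {m} {1} (s≤s z≤n) (1≤⌊m-1/2⌋ 5≤m) (suc zero)
    (λ Q sep i lives → not-¬ (proj₁ (sep i (lives (here refl)))) (lives (there (here refl)))) 𝒫₀₁ (λ _ → refl) (λ _ → refl)
  inner₁ : HasNimber (1 ⊢_⟶_) allLive (𝒢 (petersen m 1 (s≤s z≤n) (1≤⌊m-1/2⌋ 5≤m)) 𝒫₁₀)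
  inner₁ = nimber-row {m} {1} (s≤s z≤n) (1≤⌊m-1/2⌋ 5≤m) zero
    (λ Q sep i lives → not-¬ (proj₁ (sep i (lives (here refl)))) (lives (there (here refl)))) 𝒫₁₀ (λ _ → refl) (λ _ → refl)
  outer₂ : HasNimber (1 ⊢_⟶_) allLive (𝒢 (petersen m 2 (s≤s z≤n) (2≤⌊m-1/2⌋ 5≤m)) 𝒫₀₁)
  -- Play is in step 1 and the revived row has step 2: its triple contains i and i + 2, two steps of
  -- 1 apart.
  outer₂ = nimber-row {m} {2} (s≤s z≤n) (2≤⌊m-1/2⌋ 5≤m) (suc zero)
    (λ Q sep i lives → not-¬ (proj₂ (sep i (lives (here refl))))
      (trans (cong Q (shift-shift 1 1 i)) (lives (there (here refl))))) 𝒫₀₁ (λ _ → refl) (λ _ → refl)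
  inner₂ : HasNimber (2 ⊢_⟶_) allLive (𝒢 (petersen m 2 (s≤s z≤n) (2≤⌊m-1/2⌋ 5≤m)) 𝒫₁₀)
  -- Play is in step 2 and the revived row has step 1: its triple contains i - 1 and i + 1, one step
  -- of 2 apart.
  inner₂ = nimber-row {m} {2} (s≤s z≤n) (2≤⌊m-1/2⌋ 5≤m) zero
    (λ Q sep i lives → not-¬ (proj₁ (sep (unshift 1 i) (lives (there (there (here refl))))))
      (trans (cong Q (trans (sym (shift-shift 1 1 (unshift 1 i))) (cong (shift 1) (shift-unshift 1≤m i)))) (lives (there (here refl)))))
    𝒫₁₀ (λ _ → refl) (λ _ → refl)
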